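{- Suppose $2^a$ is the largest power of $2$ dividing $n$, where $a\ge 1$. Suppose $\theta=(\alpha,\beta,\gamma)\in S_n\times S_n\times S_n$ is such that the length of each cycle in $\alpha$, $\beta$ and $\gamma$ is divisible by $2^a$. Then $\theta\notin\mathrm{Atp}(n)$.
   Context: A Latin square of order $n$ is an $n\times n$ array $L=L(i,j)$ with rows, columns and symbols indexed by $[n]=\{1,\dots,n\}$ such that the symbols in every row and in every column are distinct. A triple $(\alpha,\beta,\gamma)\in S_n\times S_n\times S_n$ is an autotopism of $L$ if $\gamma(L(i,j))=L(\alpha(i),\beta(j))$ for all $i,j\in[n]$. $\mathrm{Atp}(n)$ is the set of all triples that are an autotopism of at least one Latin square of order $n$. Fixed points count as cycles of length $1$. -}

module Defs where

open import Data.Fin.Base using (Fin; toℕ)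
open import Data.Fin.Permutation using (Permutation′; _⟨$⟩ʳ_)
open import Data.Nat.Base using (ℕ; suc; NonZero; _≤_; _^_)
open import Data.Nat.Divisibility using (_∣_)
open import Data.Nat.DivMod using (_mod_)
open import Data.Product.Base using (Σ-syntax; _×_; _,_)
open import Function.Definitions using (Injective)
open import Level using (0ℓ)
open import Relation.Binary.PropositionalEquality.Core using (_≡_)
open import Relation.Unary using (Pred)

-- The index set [n] = {1,…,n} is represented by Fin n throughout.

record LatinSquare (n : ℕ) : Set where
  field
    entry           : Fin n → Fin n → Fin n
    row-distinct    : ∀ i → Injective _≡_ _≡_ (λ j → entry i j)
    column-distinct : ∀ j → Injective _≡_ _≡_ (λ i → entry i j)

Triple : ℕ → Set
Triple n = Permutation′ n × Permutation′ n × Permutation′ n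

IsAutotopism : ∀ {n} → LatinSquare n → Pred (Triple n) 0ℓ
IsAutotopism L (α , β , γ) =
  ∀ i j → γ ⟨$⟩ʳ entry i j ≡ entry (α ⟨$⟩ʳ i) (β ⟨$⟩ʳ j)
  where open LatinSquare L

Atp : ∀ n → Pred (Triple n) 0ℓ
Atp n θ = Σ[ L ∈ LatinSquare n ] IsAutotopism L θ

-- A cycle (x₀ x₁ … x_{ℓ-1}) of π: distinct points with π x_j = x_{j+1},
-- indices modulo ℓ. Fixed points are the case ℓ = 1. The same cycle is
-- represented once for each choice of starting point x₀.
record Cycle {n : ℕ} (π : Permutation′ n) : Set where
  field
    length             : ℕ
    {{length-nonZero}} : NonZero length
    point              : Fin length → Fin n
    distinct           : Injective _≡_ _≡_ point
    step               : ∀ j → π ⟨$⟩ʳ point j ≡ point (suc (toℕ j) mod length)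

CycleLengthsDivisibleBy : ∀ {n} → ℕ → Permutation′ n → Set
CycleLengthsDivisibleBy d π = (C : Cycle π) → d ∣ Cycle.length C

-- This forces n ≢ 0, since every power of 2 divides 0.
IsLargestPowerOf2Dividing : (a n : ℕ) → Set
IsLargestPowerOf2Dividing a n =
  2 ^ a ∣ n × (∀ b → 2 ^ b ∣ n → 2 ^ b ≤ 2 ^ a)

{-# OPTIONS --safe #-}
module Submission where

-- Since every cycle length is divisible by d = 2 ^ a, the points of α, β and γ
-- can be given phases x, y and z modulo d which a step along a cycle decreases
-- by one. Let [u] be the residue of u in {0, …, d − 1}. At the cell (i , j) with
-- phases x of i, y of j and z of its symbol,
--   [z − y] + [y − x] = [z − x] + d ε   with ε a natural number.
-- Phases are equidistributed, so each bracket has the same sum n A over all n²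
-- cells, where 2 A = n (d − 1); hence n A = d Σ ε. The carry ε is invariant
-- under the autotopism, so its row sums are constant along cycles of α and d
-- divides Σ ε. With n = m d this leaves m² (d − 1) = 2 (Σ ε / d), which is
-- impossible as m and d − 1 are odd.

open import Defs
import Algebra.Properties.Semiring.Sum as Sum
open import Data.Fin.Base using (Fin; zero; suc; toℕ; fromℕ; inject₁; punchOut)
open import Data.Fin.Permutation using (Permutation′; permutation; _⟨$⟩ʳ_)
open import Data.Fin.Properties as Fin
  using (any?; toℕ<n; toℕ-fromℕ; toℕ-fromℕ<; toℕ-inject₁; toℕ-injective)
open import Data.Nat.Base
open import Data.Nat.Divisibility
open import Data.Nat.DivMod
open import Data.Nat.GeneralisedArithmetic using (fold; fold-+)
open import Data.Nat.Induction using (<-rec)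
open import Data.Nat.Primality using (prime[2]; euclidsLemma)
open import Data.Nat.Properties
open import Data.Nat.Tactic.RingSolver using (solve-∀)
open import Data.Product.Base using (∃-syntax; _×_; _,_; proj₁; proj₂)
open import Data.Sum.Base using ([_,_]′)
open import Function.Base using (_∘_; id)
open import Function.Bundles using (Inverse)
open import Function.Definitions using (Injective)
open import Relation.Binary.PropositionalEquality
open import Relation.Nullary using (yes; no; contradiction)
open import Relation.Unary using (Pred; Decidable; _∉_)

open Sum +-*-semiring

least : ∀ {p} {P : Pred ℕ p} → Decidable P → ∀ {m} → P m →
        ∃[ k ] P k × (∀ {l} → P l → k ≤ l)
least {P = P} P? {m} = <-rec (λ m → P m → ∃[ k ] P k × (∀ {l} → P l → k ≤ l)) go m
  where
  go : ∀ m → (∀ {k} → k < m → P k → _) → P m → _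
  go m rec Pm with anyUpTo? P? m
  ... | yes (k , k<m , Pk) = rec k<m Pk
  ... | no ¬P<m = m , Pm , λ {l} Pl → ≮⇒≥ λ l<m → ¬P<m (l , l<m , Pl)

-- Sums over finite index sets

∑-const : ∀ n c → ∑[ i < n ] c ≡ n * c
∑-const zero    c = refl
∑-const (suc n) c = cong (c +_) (∑-const n c)

-- The sum of the residues modulo `d`, doubled to stay free of division.
∑-toℕ : ∀ d → 2 * ∑[ i < d ] toℕ i ≡ d * pred d
∑-toℕ zero    = refl
∑-toℕ (suc d) = begin
  2 * ∑[ i < d ] suc (toℕ i)       ≡⟨ cong (2 *_) (∑-distrib-+ {d} (λ _ → 1) toℕ) ⟩
  2 * (∑[ i < d ] 1 + ∑[ i < d ] toℕ i)
    ≡⟨ cong (λ s → 2 * (s + ∑[ i < d ] toℕ i)) (trans (∑-const d 1) (*-identityʳ d)) ⟩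
  2 * (d + ∑[ i < d ] toℕ i)       ≡⟨ *-distribˡ-+ 2 d _ ⟩
  2 * d + 2 * ∑[ i < d ] toℕ i     ≡⟨ cong (2 * d +_) (∑-toℕ d) ⟩
  2 * d + d * pred d               ≡⟨ step d ⟩
  suc d * d                        ∎
  where
  open ≡-Reasoning
  step : ∀ d → 2 * d + d * pred d ≡ suc d * d
  step zero    = refl
  step (suc d) = lemma d
    where
    lemma : ∀ d → 2 * suc d + suc d * d ≡ suc (suc d) * suc d
    lemma = solve-∀

-- Moving the window by one loses `g u` and gains `g (u + d)`, which are equal. Both windows sit
-- inside one of length `suc d`, so cancellation replaces subtraction.
∑-period-shift : ∀ {d} {g : ℕ → ℕ} → (∀ t → g (t + d) ≡ g t) →
                 ∀ u → ∑[ c < d ] g (u + toℕ c) ≡ ∑[ c < d ] g (toℕ c)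
∑-period-shift         periodic zero    = refl
∑-period-shift {d} {g} periodic (suc u) = trans (+-cancelˡ-≡ (g (u + 0)) _ _ rotate)
                                                (∑-period-shift periodic u)
  where
  open ≡-Reasoning
  rotate : g (u + 0) + ∑[ c < d ] g (suc u + toℕ c) ≡ g (u + 0) + ∑[ c < d ] g (u + toℕ c)
  rotate = begin
    g (u + 0) + ∑[ c < d ] g (suc u + toℕ c)
      ≡⟨ cong (g (u + 0) +_) (sum-cong-≗ {d} (λ c → cong g (sym (+-suc u (toℕ c))))) ⟩
    ∑[ c < suc d ] g (u + toℕ c)
      ≡⟨ sum-init-last {d} (λ c → g (u + toℕ c)) ⟩
    ∑[ c < d ] g (u + toℕ (inject₁ c)) + g (u + toℕ (fromℕ d))
      ≡⟨ cong₂ _+_ (sum-cong-≗ {d} (λ c → cong (λ t → g (u + t)) (toℕ-inject₁ c)))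
                   (trans (cong (λ t → g (u + t)) (toℕ-fromℕ d)) (periodic u)) ⟩
    ∑[ c < d ] g (u + toℕ c) + g u
      ≡⟨ +-comm _ (g u) ⟩
    g u + ∑[ c < d ] g (u + toℕ c)
      ≡⟨ cong (λ t → g t + ∑[ c < d ] g (u + toℕ c)) (+-identityʳ u) ⟨
    g (u + 0) + ∑[ c < d ] g (u + toℕ c) ∎

-- If `y` were missed, punching it out would inject `Fin (suc n)` into `Fin n`.
injective⇒surjective : ∀ {n} {f : Fin n → Fin n} → Injective _≡_ _≡_ f →
                       ∀ y → ∃[ x ] f x ≡ y
injective⇒surjective {suc n} {f} inj y with any? (λ x → f x Fin.≟ y)
... | yes hit = hit
... | no miss = contradiction
  (Fin.injective⇒≤ {f = λ x → punchOut (y≢f x)} (inj ∘ Fin.punchOut-injective (y≢f _) (y≢f _)))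
  1+n≰n
  where
  y≢f : ∀ x → y ≢ f x
  y≢f x y≡fx = miss (x , sym y≡fx)

injective⇒permutation : ∀ {n} {f : Fin n → Fin n} → Injective _≡_ _≡_ f → Permutation′ n
injective⇒permutation {f = f} inj = permutation f (proj₁ ∘ surj)
  (proj₂ ∘ surj) (λ x → inj (proj₂ (surj (f x))))
  where
  surj = injective⇒surjective inj

-- Meant for the lines of a Latin square, which come as injective maps rather than as permutations.
∑-injective : ∀ {n} {f : Fin n → Fin n} → Injective _≡_ _≡_ f →
              ∀ g → ∑[ i < n ] g (f i) ≡ ∑[ i < n ] g i
∑-injective inj g = sym (∑-permute g (injective⇒permutation inj))

-- Congruences

module _ (d : ℕ) .{{_ : NonZero d}} where

  %-cong-+ : ∀ {m m′ n n′} → m % d ≡ m′ % d → n % d ≡ n′ % d →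
             (m + n) % d ≡ (m′ + n′) % d
  %-cong-+ {m} {m′} {n} {n′} p q =
    trans (%-distribˡ-+ m n d)
          (trans (cong₂ (λ a b → (a + b) % d) p q) (sym (%-distribˡ-+ m′ n′ d)))

  %-cong-* : ∀ {m m′} k → m % d ≡ m′ % d → (m * k) % d ≡ (m′ * k) % d
  %-cong-* {m} {m′} k p =
    trans (%-distribˡ-* m k d)
          (trans (cong (λ a → (a * (k % d)) % d) p) (sym (%-distribˡ-* m′ k d)))

  -- Multiplying by d − 1 negates modulo d, so this is the residue of u − v.
  diff : ℕ → ℕ → ℕ
  diff u v = (u + v * pred d) % d

  -- Adding `d` as `1 + pred d` raises both arguments by one: the 1 goes to `u′`, the `pred d` to
  -- `v′ * pred d`.
  diff-suc : ∀ {u u′ v v′} → suc u′ % d ≡ u % d → suc v′ % d ≡ v % d →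
             diff u′ v′ ≡ diff u v
  diff-suc {u} {u′} {v} {v′} p q = begin
    (u′ + v′ * k) % d              ≡⟨ [m+n]%n≡m%n (u′ + v′ * k) d ⟨
    (u′ + v′ * k + d) % d          ≡⟨ cong (λ e → (u′ + v′ * k + e) % d) (suc-pred d) ⟨
    (u′ + v′ * k + suc k) % d      ≡⟨ cong (_% d) (regroup u′ v′ k) ⟩
    (suc u′ + suc v′ * k) % d      ≡⟨ %-cong-+ {suc u′} {u} p (%-cong-* {suc v′} k q) ⟩
    (u + v * k) % d                ∎
    where
    open ≡-Reasoning
    k = pred d
    regroup : ∀ u v k → u + v * k + suc k ≡ suc u + suc v * k
    regroup = solve-∀

  carry : ℕ → ℕ → ℕ → ℕ
  carry z y x = (diff z y + diff y x) / d

  -- Modulo `d` the terms in `y` cancel, as `y + y * pred d` is a multiple of `d`. So `diff z x` is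
  -- the remainder of the left side and `carry` its quotient.
  diff-trans : ∀ z y x → diff z y + diff y x ≡ diff z x + carry z y x * d
  diff-trans z y x = trans (m≡m%n+[m/n]*n (diff z y + diff y x) d)
                           (cong (_+ carry z y x * d) residue)
    where
    open ≡-Reasoning
    k = pred d
    regroup : ∀ z y x k → z + y * k + (y + x * k) ≡ z + x * k + y * suc k
    regroup = solve-∀
    residue : (diff z y + diff y x) % d ≡ diff z x
    residue = begin
      (diff z y + diff y x) % d              ≡⟨ %-distribˡ-+ (z + y * k) (y + x * k) d ⟨
      (z + y * k + (y + x * k)) % d          ≡⟨ cong (_% d) (regroup z y x k) ⟩
      (z + x * k + y * suc k) % d            ≡⟨ cong (λ e → (z + x * k + y * e) % d) (suc-pred d) ⟩
      (z + x * k + y * d) % d                ≡⟨ [m+kn]%n≡m%n (z + x * k) y d ⟩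
      diff z x                               ∎

-- Orbits of a permutation

module _ {n} (π : Permutation′ n) where

  private
    f : Fin n → Fin n
    f = π ⟨$⟩ʳ_

    _^^_ : Fin n → ℕ → Fin n
    x ^^ k = fold x f k

  ⟨$⟩ʳ-injective : Injective _≡_ _≡_ f
  ⟨$⟩ʳ-injective {x} {y} eq =
    trans (sym (Inverse.strictlyInverseʳ π x))
          (trans (cong (Inverse.from π) eq) (Inverse.strictlyInverseʳ π y))

  fold-injective : ∀ k {x y} → x ^^ k ≡ y ^^ k → x ≡ y
  fold-injective zero    eq = eq
  fold-injective (suc k) eq = fold-injective k (⟨$⟩ʳ-injective eq)

  fold-cancel : ∀ {x} k e → x ^^ (k + e) ≡ x ^^ k → x ^^ e ≡ x
  fold-cancel {x} k e eq = fold-injective k (trans (sym (fold-+ x f k)) eq)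

  -- Two of the first `n + 1` iterates coincide, and cancelling the smaller exponent gives a return
  -- time. Periods are written `suc p` so that they are visibly nonzero.
  minimal-period : ∀ x → ∃[ p ] x ^^ suc p ≡ x × (∀ {q} → x ^^ suc q ≡ x → p ≤ q)
  minimal-period x with Fin.pigeonhole (n<1+n n) (λ (i : Fin (suc n)) → x ^^ toℕ i)
  ... | i , j , i<j , eq = least (λ q → x ^^ suc q Fin.≟ x) {e} (fold-cancel (toℕ i) (suc e) closed)
    where
    e = toℕ j ∸ suc (toℕ i)
    closed : x ^^ (toℕ i + suc e) ≡ x ^^ toℕ i
    closed = trans (cong (x ^^_) (trans (+-suc (toℕ i) e) (m+[n∸m]≡n i<j))) (sym eq)

  fold-% : ∀ {x p} → x ^^ suc p ≡ x → ∀ k → x ^^ (k % suc p) ≡ x ^^ k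
  fold-% {x} {p} closed k = sym (begin
    x ^^ k                                       ≡⟨ cong (x ^^_) (m≡m%n+[m/n]*n k (suc p)) ⟩
    x ^^ (k % suc p + k / suc p * suc p)         ≡⟨ fold-+ x f (k % suc p) ⟩
    (x ^^ (k / suc p * suc p)) ^^ (k % suc p)    ≡⟨ cong (_^^ (k % suc p)) (loops (k / suc p)) ⟩
    x ^^ (k % suc p)                             ∎)
    where
    open ≡-Reasoning
    loops : ∀ q → x ^^ (q * suc p) ≡ x
    loops zero    = refl
    loops (suc q) = trans (fold-+ x f (suc p)) (trans (cong (_^^ suc p) (loops q)) closed)

  cycle : ∀ x → Cycle π
  cycle x with minimal-period x
  ... | p , closed , minimal = record
    { length   = suc p
    ; point    = λ i → x ^^ toℕ i
    ; distinct = λ {i} {j} eq → toℕ-injective (≤-antisym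
        (≮⇒≥ λ j<i → no-return (toℕ<n i) j<i (sym eq))
        (≮⇒≥ λ i<j → no-return (toℕ<n j) i<j eq))
    ; step     = λ j → trans (sym (fold-% {p = p} closed (suc (toℕ j))))
        (cong (x ^^_) (sym (toℕ-fromℕ< (m%n<n (suc (toℕ j)) (suc p)))))
    }
    where
    no-return : ∀ {i j} → j < suc p → i < j → x ^^ i ≢ x ^^ j
    no-return {i} {j} j≤p i<j eq = <⇒≱ shorter (minimal (fold-cancel i (suc e)
      (trans (cong (x ^^_) i+e≡j) (sym eq))))
      where
      e = j ∸ suc i
      i+e≡j : i + suc e ≡ j
      i+e≡j = trans (+-suc i e) (m+[n∸m]≡n i<j)
      shorter : e < p
      shorter = ≤-trans (m≤n+m (suc e) i) (≤-trans (≤-reflexive i+e≡j) (s≤s⁻¹ j≤p))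

  module _ {d} (d∣π : CycleLengthsDivisibleBy d π) where

    -- The remainder of `k` by the minimal period is again a return time; being too small to be
    -- positive, it is 0. The period is a cycle length, hence a multiple of `d`.
    return⇒∣ : ∀ {x} k → x ^^ k ≡ x → d ∣ k
    return⇒∣ {x} k eq with minimal-period x | d∣π (cycle x)
    ... | p , closed , minimal | d∣p = ∣-trans d∣p (m%n≡0⇒n∣m k (suc p) (rem≡0 _ refl))
      where
      rem≡0 : ∀ r → r ≡ k % suc p → k % suc p ≡ 0
      rem≡0 zero    r≡ = sym r≡
      rem≡0 (suc r) r≡ = contradiction
        (minimal (trans (cong (x ^^_) r≡) (trans (fold-% closed k) eq)))
        (<⇒≱ (s≤s⁻¹ (subst (_< suc p) (sym r≡) (m%n<n k (suc p)))))

    meet⇒≡% : .{{_ : NonZero d}} → ∀ {x} k l → x ^^ k ≡ x ^^ l → k % d ≡ l % d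
    meet⇒≡% k l eq = [ (λ k≤l → ordered k≤l eq) , (λ l≤k → sym (ordered l≤k (sym eq))) ]′
                       (≤-total k l)
      where
      ordered : ∀ {x k l} → k ≤ l → x ^^ k ≡ x ^^ l → k % d ≡ l % d
      ordered {x} {k} {l} k≤l eq = begin
        k % d              ≡⟨ %-remove-+ʳ k (return⇒∣ (l ∸ k) (fold-cancel k (l ∸ k)
                                (trans (cong (x ^^_) (m+[n∸m]≡n k≤l)) (sym eq)))) ⟨
        (k + (l ∸ k)) % d  ≡⟨ cong (_% d) (m+[n∸m]≡n k≤l) ⟩
        l % d              ∎
        where open ≡-Reasoning

  -- Singles out a base point that depends only on the cycle. Exponents up to one period suffice for
  -- the search.
  orbit-minimum : ∀ x → ∃[ k ] (∀ l → toℕ (x ^^ k) ≤ toℕ (x ^^ l))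
  orbit-minimum x with minimal-period x
  ... | p , closed , _ with least (λ v → anyUpTo? (λ k → toℕ (x ^^ k) ≟ v) (suc p))
                                  (0 , z<s , refl)
  ...   | v , (k , _ , refl) , smallest = k , λ l → smallest
    (l % suc p , m%n<n l (suc p) , cong toℕ (fold-% closed l))

-- Phases modulo d along cycles

-- Only the residue of `phase` matters; `suc` on the side of the image expresses a decrease by one
-- without subtraction.
record Phase {n} (d : ℕ) .{{_ : NonZero d}} (π : Permutation′ n) : Set where
  field
    phase      : Fin n → ℕ
    phase-step : ∀ x → suc (phase (π ⟨$⟩ʳ x)) % d ≡ phase x % d

-- The phase is the distance to the smallest element of the cycle.
divisible⇒Phase : ∀ {n d} .{{_ : NonZero d}} {π : Permutation′ n} →
                  CycleLengthsDivisibleBy d π → Phase d π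
divisible⇒Phase {n} {d} {π} d∣π = record
  { phase      = phase
  -- Both exponents lead from `x` to the minimum of its cycle, so they agree modulo `d`.
  ; phase-step = λ x → meet⇒≡% π d∣π (suc (phase (f x))) (phase x)
      (toℕ-injective (≤-antisym (next-minimal x)
      (proj₂ (orbit-minimum π x) (suc (phase (f x))))))
  }
  where
  open ≤-Reasoning
  f = π ⟨$⟩ʳ_
  phase = λ x → proj₁ (orbit-minimum π x)

  fold-suc : ∀ x k → fold x f (suc k) ≡ fold (f x) f k
  fold-suc x k = trans (cong (fold x f) (+-comm 1 k)) (fold-+ x f k)

  -- From `f x` the exponent `k + p` reaches the point that `k` reaches from `x`: since `k` may be
  -- 0, the path goes once more round the cycle.
  next-minimal : ∀ x → toℕ (fold x f (suc (phase (f x)))) ≤ toℕ (fold x f (phase x))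
  next-minimal x = begin
    toℕ (fold x f (suc (phase (f x))))     ≡⟨ cong toℕ (fold-suc x (phase (f x))) ⟩
    toℕ (fold (f x) f (phase (f x)))       ≤⟨ proj₂ (orbit-minimum π (f x)) (k + p) ⟩
    toℕ (fold (f x) f (k + p))             ≡⟨ cong toℕ (fold-suc x (k + p)) ⟨
    toℕ (fold x f (suc (k + p)))           ≡⟨ cong (toℕ ∘ fold x f) (+-suc k p) ⟨
    toℕ (fold x f (k + suc p))             ≡⟨ cong toℕ (fold-+ x f k) ⟩
    toℕ (fold (fold x f (suc p)) f k)
      ≡⟨ cong (λ y → toℕ (fold y f k)) (proj₁ (proj₂ (minimal-period π x))) ⟩
    toℕ (fold x f k)                       ∎
    where
    k = phase x
    p = proj₁ (minimal-period π x)

-- Both the equidistribution of phases (w constant) and the divisibility of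
-- sums of invariant weights (G an indicator) are instances of this.
phase-average : ∀ {n d} .{{_ : NonZero d}} {π : Permutation′ n} (P : Phase d π) →
                let open Phase P in
                (w : Fin n → ℕ) → (∀ i → w (π ⟨$⟩ʳ i) ≡ w i) → (G : ℕ → ℕ) → ∀ c →
                d * ∑[ i < n ] (w i * G ((phase i + c) % d)) ≡
                (∑[ i < n ] w i) * ∑[ e < d ] G (toℕ e)
phase-average {n} {d} {π} P w w-inv G c = begin
  d * S c                                                   ≡⟨ cong (d *_) (S-const c) ⟩
  d * S 0                                                   ≡⟨ ∑-const d (S 0) ⟨
  ∑[ e < d ] S 0
    ≡⟨ sum-cong-≗ {d} (λ e → S-const (toℕ e)) ⟨
  ∑[ e < d ] S (toℕ e)
    ≡⟨ ∑-comm {d} {n} (λ e i → w i * g (phase i + toℕ e)) ⟩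
  ∑[ i < n ] ∑[ e < d ] (w i * g (phase i + toℕ e))
    ≡⟨ sum-cong-≗ {n} (λ i → *-distribˡ-sum {d} (w i) (λ e → g (phase i + toℕ e))) ⟨
  ∑[ i < n ] (w i * ∑[ e < d ] g (phase i + toℕ e))
    ≡⟨ sum-cong-≗ {n} (λ i → cong (w i *_) (full-period (phase i))) ⟩
  ∑[ i < n ] (w i * ∑[ e < d ] G (toℕ e))
    ≡⟨ *-distribʳ-sum {n} (∑[ e < d ] G (toℕ e)) w ⟨
  (∑[ i < n ] w i) * ∑[ e < d ] G (toℕ e)                   ∎
  where
  open ≡-Reasoning
  open Phase P
  g : ℕ → ℕ
  g t = G (t % d)

  S : ℕ → ℕ
  S c = ∑[ i < n ] (w i * g (phase i + c))

  shift : ∀ i c → (phase i + c) % d ≡ (phase (π ⟨$⟩ʳ i) + suc c) % d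
  shift i c = trans (%-cong-+ d {phase i} {suc (phase (π ⟨$⟩ʳ i))} (sym (phase-step i)) refl)
                    (cong (_% d) (sym (+-suc (phase (π ⟨$⟩ʳ i)) c)))

  -- Reindexing by `π` trades the step of the phase for a change of the shift. Hence `d` copies of
  -- `S` can be spread over all shifts, giving each index a full period of `g`.
  S-suc : ∀ c → S (suc c) ≡ S c
  S-suc c = trans (∑-permute (λ i → w i * g (phase i + suc c)) π)
                  (sum-cong-≗ {n} (λ i → cong₂ _*_ (w-inv i) (cong G (sym (shift i c)))))

  S-const : ∀ c → S c ≡ S 0
  S-const zero    = refl
  S-const (suc c) = trans (S-suc c) (S-const c)

  full-period : ∀ u → ∑[ e < d ] g (u + toℕ e) ≡ ∑[ e < d ] G (toℕ e)
  full-period u = trans (∑-period-shift {d} {g} (λ t → cong G ([m+n]%n≡m%n t d)) u)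
                        (sum-cong-≗ {d} (λ e → cong G (m<n⇒m%n≡m (toℕ<n e))))

-- With `G` the indicator of residue 0, the total weight is `d` times the weight `S` of the points
-- of phase 0 modulo `d`.
∣-sum-invariant : ∀ {n d} .{{_ : NonZero d}} {π : Permutation′ n} → Phase d π →
                  (w : Fin n → ℕ) → (∀ i → w (π ⟨$⟩ʳ i) ≡ w i) → d ∣ ∑[ i < n ] w i
∣-sum-invariant {n} {suc k} P w w-inv = divides S (begin
  ∑[ i < n ] w i                                              ≡⟨ *-identityʳ _ ⟨
  (∑[ i < n ] w i) * 1
    ≡⟨ cong (λ s → (∑[ i < n ] w i) * suc s) (trans (∑-const k 0) (*-zeroʳ k)) ⟨
  (∑[ i < n ] w i) * ∑[ e < suc k ] G (toℕ e)                 ≡⟨ phase-average P w w-inv G 0 ⟨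
  suc k * S                                                   ≡⟨ *-comm (suc k) S ⟩
  S * suc k                                                   ∎)
  where
  open ≡-Reasoning
  G : ℕ → ℕ
  G zero    = 1
  G (suc _) = 0
  S = ∑[ i < n ] (w i * G ((Phase.phase P i + 0) % suc k))

-- Sums of phase differences

-- The case of weight 1 and `G = id`, with the shift `v * pred d` standing for subtraction of `v`.
∑-diff : ∀ {m n d} .{{_ : NonZero d}} {π : Permutation′ n} (P : Phase d π) → n ≡ m * d →
         ∀ v → 2 * ∑[ i < n ] diff d (Phase.phase P i) v ≡ n * pred d
∑-diff {m} {n} {d} P n≡md v = *-cancelˡ-≡ _ _ d (begin
  d * (2 * A)                           ≡⟨ swap d 2 A ⟩
  2 * (d * A)
    ≡⟨ cong (λ s → 2 * (d * s)) (sum-cong-≗ {n} (λ i → *-identityˡ (diff d (phase i) v))) ⟨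
  2 * (d * ∑[ i < n ] (1 * diff d (phase i) v))
    ≡⟨ cong (2 *_) (phase-average P (λ _ → 1) (λ _ → refl) id (v * pred d)) ⟩
  2 * (∑[ i < n ] 1 * ∑[ e < d ] toℕ e)
    ≡⟨ cong (λ s → 2 * (s * ∑[ e < d ] toℕ e)) (trans (∑-const n 1) (*-identityʳ n)) ⟩
  2 * (n * ∑[ e < d ] toℕ e)            ≡⟨ swap 2 n (∑[ e < d ] toℕ e) ⟩
  n * (2 * ∑[ e < d ] toℕ e)            ≡⟨ cong (n *_) (∑-toℕ d) ⟩
  n * (d * pred d)                      ≡⟨ swap n d (pred d) ⟩
  d * (n * pred d)                      ∎)
  where
  open ≡-Reasoning
  open Phase P
  A = ∑[ i < n ] diff d (phase i) v
  swap : ∀ a b c → a * (b * c) ≡ b * (a * c)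
  swap = solve-∀

∑∑-diff : ∀ {n d A} .{{_ : NonZero d}} (u v : Fin n → Fin n → ℕ) →
          (∀ i → 2 * ∑[ j < n ] diff d (u i j) (v i j) ≡ A) →
          2 * ∑[ i < n ] ∑[ j < n ] diff d (u i j) (v i j) ≡ n * A
∑∑-diff {n} {d} {A} u v rows = begin
  2 * ∑[ i < n ] ∑[ j < n ] diff d (u i j) (v i j)
    ≡⟨ *-distribˡ-sum {n} 2 (λ i → ∑[ j < n ] diff d (u i j) (v i j)) ⟩
  ∑[ i < n ] (2 * ∑[ j < n ] diff d (u i j) (v i j))  ≡⟨ sum-cong-≗ {n} rows ⟩
  ∑[ i < n ] A                                        ≡⟨ ∑-const n A ⟩
  n * A                                               ∎
  where open ≡-Reasoning

-- Carries over the cells of a Latin square with an autotopism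

module _ {n d} .{{_ : NonZero d}} {α β γ : Permutation′ n}
         (L : LatinSquare n) (auto : IsAutotopism L (α , β , γ))
         (P : Phase d α) (Q : Phase d β) (R : Phase d γ) where

  open LatinSquare L
  open ≡-Reasoning

  private
    x = Phase.phase P
    y = Phase.phase Q
    z : Fin n → Fin n → ℕ
    z i j = Phase.phase R (entry i j)

    z-step : ∀ i j → suc (z (α ⟨$⟩ʳ i) (β ⟨$⟩ʳ j)) % d ≡ z i j % d
    z-step i j = trans (cong (λ s → suc (Phase.phase R s) % d) (sym (auto i j)))
                       (Phase.phase-step R (entry i j))

    ε : Fin n → Fin n → ℕ
    ε i j = carry d (z i j) (y j) (x i)

    -- One step of the autotopism lowers all three phases by one modulo `d`, leaving their
    -- differences unchanged.
    ε-invariant : ∀ i j → ε (α ⟨$⟩ʳ i) (β ⟨$⟩ʳ j) ≡ ε i j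
    ε-invariant i j = cong (_/ d) (cong₂ _+_
      (diff-suc d (z-step i j) (Phase.phase-step Q j))
      (diff-suc d (Phase.phase-step Q j) (Phase.phase-step P i)))

    row : Fin n → ℕ
    row i = ∑[ j < n ] ε i j

    row-invariant : ∀ i → row (α ⟨$⟩ʳ i) ≡ row i
    row-invariant i = trans (∑-permute (ε (α ⟨$⟩ʳ i)) β) (sum-cong-≗ {n} (ε-invariant i))

    ∑∑ : (Fin n → Fin n → ℕ) → ℕ
    ∑∑ f = ∑[ i < n ] ∑[ j < n ] f i j

    ∑∑-distrib-+ : ∀ f g → ∑∑ (λ i j → f i j + g i j) ≡ ∑∑ f + ∑∑ g
    ∑∑-distrib-+ f g = trans (sum-cong-≗ {n} (λ i → ∑-distrib-+ {n} (f i) (g i)))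
                             (∑-distrib-+ {n} (λ i → ∑[ j < n ] f i j) (λ i → ∑[ j < n ] g i j))

    Szy Syx Szx : ℕ
    Szy = ∑∑ (λ i j → diff d (z i j) (y j))
    Syx = ∑∑ (λ i j → diff d (y j) (x i))
    Szx = ∑∑ (λ i j → diff d (z i j) (x i))

    carries : Szy + Syx ≡ Szx + ∑∑ ε * d
    carries = begin
      Szy + Syx
        ≡⟨ ∑∑-distrib-+ (λ i j → diff d (z i j) (y j)) (λ i j → diff d (y j) (x i)) ⟨
      ∑∑ (λ i j → diff d (z i j) (y j) + diff d (y j) (x i))
        ≡⟨ sum-cong-≗ {n} (λ i → sum-cong-≗ {n} (λ j → diff-trans d (z i j) (y j) (x i))) ⟩
      ∑∑ (λ i j → diff d (z i j) (x i) + ε i j * d)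
        ≡⟨ ∑∑-distrib-+ (λ i j → diff d (z i j) (x i)) (λ i j → ε i j * d) ⟩
      Szx + ∑∑ (λ i j → ε i j * d)
        ≡⟨ cong (Szx +_) (trans
             (sum-cong-≗ {n} (λ i → sym (*-distribʳ-sum {n} d (ε i))))
             (sym (*-distribʳ-sum {n} d row))) ⟩
      Szx + ∑∑ ε * d ∎

  2∣m²[d-1] : ∀ {m} → n ≡ m * d → 2 ∣ m * m * pred d
  2∣m²[d-1] {m} n≡md with ∣-sum-invariant P row row-invariant
  ... | divides F ∑ε≡Fd = divides F (*-cancelˡ-≡ _ _ (d * d) {{m*n≢0 d d}} (begin
    d * d * (m * m * pred d)     ≡⟨ regroup₁ d m (pred d) ⟩
    m * d * (m * d * pred d)     ≡⟨ cong (λ t → t * (t * pred d)) n≡md ⟨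
    N                            ≡⟨ +-cancelˡ-≡ N N _ doubled ⟩
    2 * (∑∑ ε * d)               ≡⟨ cong (λ s → 2 * (s * d)) ∑ε≡Fd ⟩
    2 * (F * d * d)              ≡⟨ regroup₂ d F ⟩
    d * d * (F * 2)              ∎))
    where
    -- Twice the sum over all cells that the three differences have in common.
    N = n * (n * pred d)
    regroup₁ : ∀ d m k → d * d * (m * m * k) ≡ m * d * (m * d * k)
    regroup₁ = solve-∀
    regroup₂ : ∀ d F → 2 * (F * d * d) ≡ d * d * (F * 2)
    regroup₂ = solve-∀

    -- Summing by columns keeps `y j` fixed while the entries run through every symbol once; for
    -- `Szx` rows do the same with `x i`.
    2Szy≡N : 2 * Szy ≡ N
    2Szy≡N = trans (cong (2 *_) (∑-comm {n} {n} (λ i j → diff d (z i j) (y j))))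
      (∑∑-diff (λ j i → z i j) (λ j i → y j) λ j →
        trans (cong (2 *_) (∑-injective (column-distinct j) (λ s → diff d (Phase.phase R s) (y j))))
              (∑-diff {m} R n≡md (y j)))

    2Syx≡N : 2 * Syx ≡ N
    2Syx≡N = ∑∑-diff (λ i j → y j) (λ i j → x i) λ i → ∑-diff {m} Q n≡md (x i)

    2Szx≡N : 2 * Szx ≡ N
    2Szx≡N = ∑∑-diff z (λ i j → x i) λ i →
      trans (cong (2 *_) (∑-injective (row-distinct i) (λ s → diff d (Phase.phase R s) (x i))))
            (∑-diff {m} R n≡md (x i))

    doubled : N + N ≡ N + 2 * (∑∑ ε * d)
    doubled = begin
      N + N                           ≡⟨ cong₂ _+_ 2Szy≡N 2Syx≡N ⟨
      2 * Szy + 2 * Syx               ≡⟨ *-distribˡ-+ 2 Szy Syx ⟨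
      2 * (Szy + Syx)                 ≡⟨ cong (2 *_) carries ⟩
      2 * (Szx + ∑∑ ε * d)            ≡⟨ *-distribˡ-+ 2 Szx (∑∑ ε * d) ⟩
      2 * Szx + 2 * (∑∑ ε * d)        ≡⟨ cong (_+ 2 * (∑∑ ε * d)) 2Szx≡N ⟩
      N + 2 * (∑∑ ε * d)              ∎

-- The parity contradiction

2∤pred : ∀ {d} .{{_ : NonZero d}} → 2 ∣ d → 2 ∤ pred d
2∤pred {suc k} 2∣d 2∣k = contradiction
  (∣1⇒≡1 (∣m+n∣m⇒∣n (subst (2 ∣_) (+-comm 1 k) 2∣d) 2∣k))
  λ ()

corollary5p3 : (n a : ℕ) → a ≥ 1 → IsLargestPowerOf2Dividing a n →
    (α β γ : Permutation′ n) →
    CycleLengthsDivisibleBy (2 ^ a) α →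
    CycleLengthsDivisibleBy (2 ^ a) β →
    CycleLengthsDivisibleBy (2 ^ a) γ →
    (α , β , γ) ∉ Atp n
corollary5p3 n a@(suc a′) _ (divides m n≡md , largest) α β γ dα dβ dγ (L , auto) =
  -- The prime 2 divides `m` or `2 ^ a - 1`; the latter is odd because `a` is a successor.
  [ [ 2∤m , 2∤m ]′ ∘ euclidsLemma m m prime[2] , 2∤pred (m∣m*n (2 ^ a′)) ]′
    (euclidsLemma (m * m) (pred (2 ^ a)) prime[2]
      (2∣m²[d-1] L auto (divisible⇒Phase dα) (divisible⇒Phase dβ) (divisible⇒Phase dγ) {m} n≡md))
  where
  instance
    2^a≢0 : NonZero (2 ^ a)
    2^a≢0 = m^n≢0 2 a

  2∤m : 2 ∤ m
  -- An even `m` would make `2 ^ suc a` a divisor of `n`, exceeding the largest power.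
  2∤m 2∣m = <⇒≱ (^-monoʳ-< 2 (s≤s (s≤s z≤n)) (n<1+n a))
    (largest (suc a) (subst (2 ^ suc a ∣_) (sym n≡md) (*-monoˡ-∣ (2 ^ a) 2∣m)))
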